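{- Let $\mathcal{A}$ be a finite alphabet with $|\mathcal{A}|\ge 6$. Then Ann has a winning strategy in the erase-repetition game over $\mathcal{A}$: she has a strategy such that, against any strategy of Ben, the length of the shared word is unbounded over the course of the play.
   Context: A square is a word of the form $uu$ with $u$ a non-empty word (any period $|u|\ge1$, including $aa$ for a letter $a$). The erase-repetition game over an alphabet $\mathcal{A}$ is played by Ann and Ben, who, starting from the empty word, alternately append one letter of $\mathcal{A}$ to the end of a shared word, Ann playing first. As soon as a square $uu$ occurs (as a suffix of the current word), the second half $u$ of that square is erased from the word. The goal of Ann is to build arbitrarily long words; Ben tries to keep the length of the word bounded. -}

module Defs where

open import Data.Nat using (ℕ; zero; suc; _+_; _*_; _≤_; _≤?_)
open import Data.Bool using (Bool; true; false; not)
open import Data.Fin using (Fin)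
open import Data.Fin.Properties using () renaming (_≟_ to _≟ᶠ_)
open import Data.List using (List; []; _∷_; _++_; [_]; length; reverse; take; drop)
open import Data.List.Properties using (≡-dec)
open import Data.Product using (_×_; _,_; proj₁; proj₂)
open import Relation.Nullary using (yes; no)

Word : ℕ → Set
Word k = List (Fin k)

private
  _≟w_ : ∀ {k} (u v : Word k) → _
  _≟w_ = ≡-dec _≟ᶠ_

-- Erasure on the REVERSED word r = reverse w.
-- Search periods p = i, i+1, …, (fuel bounds the search): if the last 2p
-- letters of w form a square uu with |u| = p (i.e. the first 2p letters of r
-- are v v with v = reverse u), erase the second half u (i.e. drop p from r).
-- The shortest such period is chosen (after appending a letter to a
-- square-free word there is in fact at most one square suffix).
eraseRev : ∀ {k} → ℕ → ℕ → Word k → Word k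
eraseRev zero    p r = r
eraseRev (suc f) p r with (p + p) ≤? length r
... | no _ = r
... | yes _ with take p r ≟w take p (drop p r)
...   | yes _ = drop p r
...   | no _  = eraseRev f (suc p) r

eraseSquare : ∀ {k} → Word k → Word k
eraseSquare w = reverse (eraseRev (length w) 1 (reverse w))

move : ∀ {k} → Word k → Fin k → Word k
move w a = eraseSquare (w ++ [ a ])

-- A strategy (for either player) chooses the next letter from the full
-- history of letters played so far (in order of play) — the most general
-- notion of (deterministic) strategy; the current word is a function of it.
Strategy : ℕ → Set
Strategy k = List (Fin k) → Fin k

annTurn : ℕ → Bool
annTurn zero = true
annTurn (suc n) = not (annTurn n)

play : ∀ {k} → Strategy k → Strategy k → ℕ → List (Fin k) × Word k
play ann ben zero = [] , []
play ann ben (suc n) with play ann ben n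
... | (h , w) with annTurn n
...   | true  = let a = ann h in (h ++ [ a ]) , move w a
...   | false = let a = ben h in (h ++ [ a ]) , move w a

wordLength : ∀ {k} → Strategy k → Strategy k → ℕ → ℕ
wordLength ann ben n = length (proj₂ (play ann ben n))

{-# OPTIONS --safe #-}
-- Ann's strategy is explicit. In a word w call p ≥ 3 a threat of length ℓ ≥ 1 if ℓ is the largest
-- number such that the last ℓ letters of w also occur p places earlier, and give it the weight
-- 2^-⌈(p-ℓ)/2⌉. When Ann is to move the weights sum to less than 2. Every threat is continued by
-- exactly one letter, so among six letters there is one that differs from the last two letters of w
-- and continues threats of total weight less than 1/2. Ann plays it: neither this letter nor
-- Ben's answer then completes a square, except that Ben may repeat Ann's letter, which amounts to
-- a pass. The two moves at most double the weight of a continued threat, giving less than 1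
-- in total. Any other threat now has length at most 2, hence weight at most 2^-i if p is 2i+1 or
-- 2i+2; for each i at most one of these two occurs, as otherwise w would contain two equal adjacent
-- letters. So the new threats weigh less than 1 and the bound 2 persists.
module Submission where

open import Defs
import Algebra.Properties.CommutativeMonoid.Sum
open import Data.Bool using (true; false; if_then_else_)
open import Data.Fin using (Fin; zero; suc; inject≤)
open import Data.Fin.Properties using (any?) renaming (_≟_ to _≟ᶠ_)
open import Data.List using (List; []; _∷_; _++_; [_]; length; reverse; take; drop; head; foldl)
open import Data.List.Properties
  using (≡-dec; drop-all; drop-[]; foldl-∷ʳ; reverse-++; reverse-involutive; length-reverse; length-++; ∷-injective)
open import Data.List.Relation.Unary.Linked using (Linked; []; [-]; _∷_)
open import Data.Maybe using (Maybe; just; nothing)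
import Data.Maybe.Properties as Maybe
open import Data.Nat
  using (ℕ; zero; suc; _+_; _*_; _∸_; _^_; _≤_; _<_; _≤?_; _<?_; z≤n; s≤s; s≤s⁻¹; ⌊_/2⌋; ⌈_/2⌉)
open import Data.Nat.Properties
open import Data.Nat.Tactic.RingSolver using (solve-∀)
open import Data.Product using (Σ; ∃; _×_; _,_; proj₁; proj₂)
open import Data.Sum using (_⊎_; inj₁; inj₂)
open import Function using (_∘_)
open import Relation.Binary.PropositionalEquality using (_≡_; _≢_; refl; sym; trans; cong; cong₂; subst)
open import Relation.Nullary using (Dec; yes; no; does; contradiction)
open Algebra.Properties.CommutativeMonoid.Sum +-0-commutativeMonoid using (sum; ∑-distrib-+; sum-replicate-zero)
open ≤-Reasoning

-- Sums over periods and letters, rounded halves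

Σ< : ℕ → (ℕ → ℕ) → ℕ
Σ< zero    f = 0
Σ< (suc n) f = Σ< n f + f n

Σ<-mono : ∀ n {f g} → (∀ i → f i ≤ g i) → Σ< n f ≤ Σ< n g
Σ<-mono zero    f≤g = z≤n
Σ<-mono (suc n) f≤g = +-mono-≤ (Σ<-mono n f≤g) (f≤g n)

Σ<-*ˡ : ∀ n m f → Σ< n (λ i → m * f i) ≡ m * Σ< n f
Σ<-*ˡ zero    m f = sym (*-zeroʳ m)
Σ<-*ˡ (suc n) m f = trans (cong (_+ m * f n) (Σ<-*ˡ n m f)) (sym (*-distribˡ-+ m (Σ< n f) (f n)))

term≤Σ< : ∀ n f {i} → i < n → f i ≤ Σ< n f
term≤Σ< (suc n) f i<1+n with m≤n⇒m<n∨m≡n (s≤s⁻¹ i<1+n)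
... | inj₁ i<n  = ≤-trans (term≤Σ< n f i<n) (m≤m+n _ _)
... | inj₂ refl = m≤n+m _ _

sum-Σ<-≤ : ∀ {k} n (f : ℕ → Fin k → ℕ) g → (∀ i → sum (f i) ≤ g i) →
           sum (λ c → Σ< n (λ i → f i c)) ≤ Σ< n g
sum-Σ<-≤ {k} zero    f g f≤g = ≤-reflexive (sum-replicate-zero k)
sum-Σ<-≤     (suc n) f g f≤g = begin
  sum (λ c → Σ< n (λ i → f i c) + f n c)           ≡⟨ ∑-distrib-+ _ (f n) ⟩
  sum (λ c → Σ< n (λ i → f i c)) + sum (f n)       ≤⟨ +-mono-≤ (sum-Σ<-≤ n f g f≤g) (f≤g n) ⟩
  Σ< n g + g n                                     ∎

sum-lowerBound : ∀ {k t} (f : Fin k → ℕ) → (∀ c → t ≤ f c) → k * t ≤ sum f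
sum-lowerBound {zero}  f t≤f = z≤n
sum-lowerBound {suc k} f t≤f = +-mono-≤ (t≤f zero) (sum-lowerBound (f ∘ suc) (t≤f ∘ suc))

_≟ᵐ_ : ∀ {k} (x y : Maybe (Fin k)) → Dec (x ≡ y)
_≟ᵐ_ = Maybe.≡-dec _≟ᶠ_

-- At most one letter passes the test, so each threat adds to the cost of at most one letter.
sum-indicator : ∀ {k} (x : Maybe (Fin k)) g → sum (λ c → if does (x ≟ᵐ just c) then g else 0) ≤ g
sum-indicator {k}     nothing        g = ≤-trans (≤-reflexive (sum-replicate-zero k)) z≤n
sum-indicator {suc k} (just zero)    g = ≤-reflexive (trans (cong (g +_) (sum-replicate-zero k)) (+-identityʳ g))
sum-indicator {suc k} (just (suc x)) g = sum-indicator (just x) g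

suc-∸-≤ : ∀ m n → suc m ∸ n ≤ suc (m ∸ n)
suc-∸-≤ m       zero    = ≤-refl
suc-∸-≤ zero    (suc n) = ≤-trans (≤-reflexive (0∸n≡0 n)) z≤n
suc-∸-≤ (suc m) (suc n) = suc-∸-≤ m n

⌈n/2⌉≤1+⌈[n∸2]/2⌉ : ∀ n → ⌈ n /2⌉ ≤ suc ⌈ n ∸ 2 /2⌉
⌈n/2⌉≤1+⌈[n∸2]/2⌉ zero          = z≤n
⌈n/2⌉≤1+⌈[n∸2]/2⌉ (suc zero)    = ≤-refl
⌈n/2⌉≤1+⌈[n∸2]/2⌉ (suc (suc n)) = ≤-refl

⌈n/2⌉≥2⇒n≥3 : ∀ n → 2 ≤ ⌈ n /2⌉ → 3 ≤ n
⌈n/2⌉≥2⇒n≥3 (suc zero) (s≤s ())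
⌈n/2⌉≥2⇒n≥3 (suc (suc zero)) (s≤s ())
⌈n/2⌉≥2⇒n≥3 (suc (suc (suc n))) _ = s≤s (s≤s (s≤s z≤n))

⌊n*2/2⌋≡n : ∀ n → ⌊ n * 2 /2⌋ ≡ n
⌊n*2/2⌋≡n zero    = refl
⌊n*2/2⌋≡n (suc n) = cong suc (⌊n*2/2⌋≡n n)

⌈n*2/2⌉≡n : ∀ n → ⌈ n * 2 /2⌉ ≡ n
⌈n*2/2⌉≡n zero    = refl
⌈n*2/2⌉≡n (suc n) = cong suc (⌈n*2/2⌉≡n n)

-- Periods, square suffixes and erasure

-- Words are reversed here (the last letter is the head of the list), except those passed to or returned by move.

module _ {k : ℕ} where

  repeats? : ∀ p (w : Word k) (a : Fin k) → Dec (head (drop p (a ∷ w)) ≡ just a)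
  repeats? p w a = head (drop p (a ∷ w)) ≟ᵐ just a

  -- The length of the threat of period `p`; for `p ≥ 1` the word ends in a square of that period
  -- exactly when this number reaches `p`.
  matched : ℕ → Word k → ℕ
  matched p []      = 0
  matched p (a ∷ w) = if does (repeats? p w a) then suc (matched p w) else 0

  matched-∷≤ : ∀ p a w → matched p (a ∷ w) ≤ suc (matched p w)
  matched-∷≤ p a w with does (repeats? p w a)
  ... | true  = ≤-refl
  ... | false = z≤n

  matched-∷-no : ∀ p a w → head (drop p (a ∷ w)) ≢ just a → matched p (a ∷ w) ≡ 0
  matched-∷-no p a w ¬r with repeats? p w a
  ... | yes r = contradiction r ¬r
  ... | no _  = refl

  matched≥length : ∀ p w → length w ≤ p → matched p w ≡ 0
  matched≥length p []      _   = refl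
  matched≥length p (a ∷ w) w≤p =
    matched-∷-no p a w (subst (λ v → head v ≢ just a) (sym (drop-all p (a ∷ w) w≤p)) λ ())

  drop-tail : ∀ p (v : Word k) {x u} → drop p v ≡ x ∷ u → drop (suc p) v ≡ u
  drop-tail zero    (_ ∷ _) refl = refl
  drop-tail (suc p) (_ ∷ v) eq   = drop-tail p v eq

  -- At `j = p` the equation is the test made by `eraseRev`; a general `j` lets the induction run
  -- letter by letter.
  take≡⇒≤matched : ∀ j p w → j + p ≤ length w → take j w ≡ take j (drop p w) → j ≤ matched p w
  take≡⇒≤matched zero    p w       _ _  = z≤n
  take≡⇒≤matched (suc j) p (a ∷ w) (s≤s j+p≤w) eq
    -- Abstracting `drop-tail` as well keeps the link between the tail `u` and `drop p w` needed for
    -- the recursive call.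
    with drop p (a ∷ w) | drop-tail p (a ∷ w)
  ... | []    | _    with () ← eq
  ... | x ∷ u | tail with ∷-injective eq
  ...   | refl , eq′ with a ≟ᶠ a
  ...     | yes _  = s≤s (take≡⇒≤matched j p w j+p≤w (trans eq′ (cong (take j) (sym (tail refl)))))
  ...     | no a≢a = contradiction refl a≢a

  NoSquareSuffix : Word k → Set
  NoSquareSuffix w = ∀ p → 1 ≤ p → matched p w < p

  eraseRev-noSquareSuffix : ∀ f p w → 1 ≤ p → NoSquareSuffix w → eraseRev f p w ≡ w
  eraseRev-noSquareSuffix zero    p w 1≤p sf = refl
  eraseRev-noSquareSuffix (suc f) p w 1≤p sf with (p + p) ≤? length w
  ... | no _ = refl
  ... | yes 2p≤w with ≡-dec _≟ᶠ_ (take p w) (take p (drop p w))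
  ...   | yes eq = contradiction (take≡⇒≤matched p p w 2p≤w eq) (<⇒≱ (sf p 1≤p))
  ...   | no _   = eraseRev-noSquareSuffix f (suc p) w (s≤s z≤n) sf

  -- Period 1 is tried first, so a repeated letter vanishes at once: this is Ben's pass.
  eraseRev-double : ∀ f a (w : Word k) → eraseRev (suc f) 1 (a ∷ a ∷ w) ≡ a ∷ w
  eraseRev-double f a w with 2 ≤? suc (suc (length w))
  ... | no 2≰ = contradiction (s≤s (s≤s z≤n)) 2≰
  ... | yes _ with ≡-dec _≟ᶠ_ (a ∷ []) (a ∷ [])
  ...   | yes _  = refl
  ...   | no a≢a = contradiction refl a≢a

  move-reverse : ∀ (w : Word k) a → move w a ≡ reverse (eraseRev (suc (length w)) 1 (a ∷ reverse w))
  move-reverse w a = cong₂ (λ f v → reverse (eraseRev f 1 v))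
    (trans (length-++ w) (+-comm (length w) 1)) (reverse-++ w [ a ])

  consecutive-repeats : ∀ p {a} {v : Word k} → Linked _≢_ v → head (drop p v) ≡ just a →
                        head (drop (suc p) v) ≢ just a
  consecutive-repeats zero    [-]     _    ()
  consecutive-repeats zero    (x≢y ∷ _) refl refl = x≢y refl
  consecutive-repeats (suc p) [-]     h h′ = contradiction (subst (λ v → head v ≡ just _) (drop-[] p) h) λ ()
  consecutive-repeats (suc p) (_ ∷ l) h h′ = consecutive-repeats p l h h′

  -- If both were positive, the last letter would equal the letters `p` and `suc p` places earlier,
  -- and these are neighbours.
  matched-p⊎1+p≡0 : ∀ p {w} → Linked _≢_ w → matched p w ≡ 0 ⊎ matched (suc p) w ≡ 0
  matched-p⊎1+p≡0 p {[]}    _ = inj₁ refl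
  matched-p⊎1+p≡0 p {a ∷ w} l with repeats? p w a
  ... | no _  = inj₁ refl
  ... | yes r = inj₂ (matched-∷-no (suc p) a w (consecutive-repeats p l r))

  -- Weights of threats and costs of letters

  -- Weights are scaled so that 2 ^ n stands for 1/2; periods above 2 + 2 n are left out, which loses nothing if n ≥ length w.
  weight : ℕ → ℕ → ℕ → ℕ
  weight n p zero      = 0
  weight n p ℓ@(suc _) = 2 ^ (suc n ∸ ⌈ p ∸ ℓ /2⌉)

  Φ : ℕ → Word k → ℕ
  Φ n w = Σ< (n * 2) (λ j → weight n (3 + j) (matched (3 + j) w))

  charge : ℕ → Word k → ℕ → Fin k → ℕ
  charge p w g c = if does (repeats? p w c) then g else 0

  continued : ℕ → Word k → Fin k → ℕ → ℕ
  continued n w c j = charge (3 + j) w (weight n (3 + j) (matched (3 + j) w)) c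

  -- The last two letters are charged 1/2 each: a letter of cost less than 1/2 avoids them, and the
  -- costs of all letters add up to less than 1/2 + 1/2 + 2 = 6 · 1/2.
  cost : ℕ → Word k → Fin k → ℕ
  cost n w c = charge 1 w (2 ^ n) c + (charge 2 w (2 ^ n) c + Σ< (n * 2) (continued n w c))

  Σ-continued≤cost : ∀ n w c → Σ< (n * 2) (continued n w c) ≤ cost n w c
  Σ-continued≤cost n w c = ≤-trans (m≤n+m _ (charge 2 w (2 ^ n) c)) (m≤n+m _ (charge 1 w (2 ^ n) c))

  sum-cost : ∀ n w → sum (cost n w) ≤ 2 ^ n + (2 ^ n + Φ n w)
  sum-cost n w = begin
    sum (cost n w)                                   ≡⟨ ∑-distrib-+ (charge 1 w (2 ^ n)) _ ⟩
    sum (charge 1 w (2 ^ n)) + sum (λ c → charge 2 w (2 ^ n) c + Σ< (n * 2) (continued n w c))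
      ≡⟨ cong (sum (charge 1 w (2 ^ n)) +_) (∑-distrib-+ (charge 2 w (2 ^ n)) _) ⟩
    sum (charge 1 w (2 ^ n)) + (sum (charge 2 w (2 ^ n)) + sum (λ c → Σ< (n * 2) (continued n w c)))
      ≤⟨ +-mono-≤ (sum-indicator (head w) _) (+-mono-≤ (sum-indicator (head (drop 1 w)) _)
           (sum-Σ<-≤ (n * 2) (λ j c → continued n w c j) _ (λ j → sum-indicator (head (drop (2 + j) w)) _))) ⟩
    2 ^ n + (2 ^ n + Φ n w) ∎

  weight-mono : ∀ n p {ℓ m} → ℓ ≤ m → 1 ≤ m → weight n p ℓ ≤ 2 ^ (suc n ∸ ⌈ p ∸ m /2⌉)
  weight-mono n p {zero}  ℓ≤m 1≤m = z≤n
  weight-mono n p {suc ℓ} ℓ≤m 1≤m = ^-monoʳ-≤ 2 (∸-monoʳ-≤ (suc n) (⌈n/2⌉-mono (∸-monoʳ-≤ p ℓ≤m)))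

  weight-suc-scale : ∀ n p ℓ → weight (suc n) p ℓ ≤ 2 * weight n p ℓ
  weight-suc-scale n p zero    = z≤n
  weight-suc-scale n p (suc ℓ) = ^-monoʳ-≤ 2 (suc-∸-≤ (suc n) ⌈ p ∸ suc ℓ /2⌉)

  -- A finer scale at most doubles each weight, and the two periods that enter the sum exceed the
  -- length of `w`, so nothing is matched at them.
  Φ-suc : ∀ n w → length w ≤ n → Φ (suc n) w ≤ 2 * Φ n w
  Φ-suc n w w≤n = begin
    Σ< (n * 2) g + g (n * 2) + g (suc (n * 2))
      ≡⟨ cong₂ (λ x y → Σ< (n * 2) g + x + y) (g≡0 (n * 2) ≤-refl) (g≡0 (suc (n * 2)) (n≤1+n _)) ⟩
    Σ< (n * 2) g + 0 + 0
      ≡⟨ trans (+-identityʳ _) (+-identityʳ _) ⟩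
    Σ< (n * 2) g
      ≤⟨ Σ<-mono (n * 2) (λ j → weight-suc-scale n (3 + j) (matched (3 + j) w)) ⟩
    Σ< (n * 2) (λ j → 2 * weight n (3 + j) (matched (3 + j) w))
      ≡⟨ Σ<-*ˡ (n * 2) 2 _ ⟩
    2 * Φ n w ∎
    where
    g : ℕ → ℕ
    g j = weight (suc n) (3 + j) (matched (3 + j) w)
    g≡0 : ∀ j → n * 2 ≤ j → g j ≡ 0
    g≡0 j n*2≤j = cong (weight (suc n) (3 + j)) (matched≥length (3 + j) w
      (≤-trans w≤n (≤-trans (m≤m*n n 2) (≤-trans n*2≤j (m≤n+m j 3)))))

  -- A weight below 1/2 forces the rounded half of the missing length to be at least 2, so at least
  -- three letters are missing.
  weight<2^n⇒ : ∀ n p ℓ → weight n p (suc ℓ) < 2 ^ n → 3 + suc ℓ ≤ p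
  weight<2^n⇒ n p ℓ wt< = m≤o∸n⇒m+n≤o 3 (<⇒≤ (m∸n≢0⇒n<m (m<n⇒n≢0 3≤p∸ℓ))) 3≤p∸ℓ
    where
    2≤exponent : ∀ x → 2 ^ (suc n ∸ x) < 2 ^ n → 2 ≤ x
    2≤exponent zero          lt = contradiction (^-monoʳ-≤ 2 (n≤1+n n)) (<⇒≱ lt)
    2≤exponent (suc zero)    lt = contradiction lt (<-irrefl refl)
    2≤exponent (suc (suc x)) _  = s≤s (s≤s z≤n)
    3≤p∸ℓ : 3 ≤ p ∸ suc ℓ
    3≤p∸ℓ = ⌈n/2⌉≥2⇒n≥3 (p ∸ suc ℓ) (2≤exponent ⌈ p ∸ suc ℓ /2⌉ wt<)

  charge<⇒¬repeats : ∀ p w g c → charge p w g c < g → head (drop p (c ∷ w)) ≢ just c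
  charge<⇒¬repeats p w g c lt with repeats? p w c
  ... | yes _ = contradiction lt (<-irrefl refl)
  ... | no ¬r = ¬r

  charge-weight<⇒matched : ∀ n p w c → 3 ≤ p → charge p w (weight n p (matched p w)) c < 2 ^ n →
                          2 + matched p (c ∷ w) ≤ p
  charge-weight<⇒matched n p w c 3≤p lt with repeats? p w c
  ... | no _  = ≤-trans (n≤1+n 2) 3≤p
  ... | yes _ with matched p w
  ...   | zero  = 3≤p
  ...   | suc ℓ = weight<2^n⇒ n p ℓ lt

  cost<⇒≢last : ∀ n w c → cost n w c < 2 ^ n → head w ≢ just c
  cost<⇒≢last n w c lt = charge<⇒¬repeats 1 w (2 ^ n) c (≤-<-trans (m≤m+n _ _) lt)

  -- After Ann's letter two letters are still missing from a square of period `p`, so Ben cannot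
  -- complete it. Period 2 is barred by its own charge, periods up to `2 + n * 2` by their weights,
  -- and longer ones by the length of `w`.
  cost<⇒matched : ∀ n w c → length w ≤ n → cost n w c < 2 ^ n → ∀ p → 2 ≤ p → 2 + matched p (c ∷ w) ≤ p
  cost<⇒matched n w c w≤n lt (suc zero) (s≤s ())
  cost<⇒matched n w c w≤n lt (suc (suc zero)) 2≤p =
    ≤-reflexive (cong (2 +_) (matched-∷-no 2 c w (charge<⇒¬repeats 2 w (2 ^ n) c
      (≤-<-trans (≤-trans (m≤m+n _ _) (m≤n+m _ (charge 1 w (2 ^ n) c))) lt))))
  cost<⇒matched n w c w≤n lt p@(suc (suc (suc j))) 2≤p with j <? n * 2
  ... | yes j<n*2 = charge-weight<⇒matched n p w c (s≤s (s≤s (s≤s z≤n)))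
          (≤-<-trans (≤-trans (term≤Σ< (n * 2) (continued n w c) j<n*2) (Σ-continued≤cost n w c)) lt)
  ... | no j≮n*2  = ≤-trans
          (+-monoʳ-≤ 2 (≤-trans (matched-∷≤ p c w) (≤-reflexive (cong suc (matched≥length p w w≤p)))))
          (s≤s (s≤s (s≤s z≤n)))
    where
    w≤p : length w ≤ p
    w≤p = ≤-trans w≤n (≤-trans (m≤m*n n 2) (≤-trans (≮⇒≥ j≮n*2) (m≤n+m j 3)))

  -- The potential over one round

  -- If `c` continues a threat of positive length, two more letters lower the rounded half by at
  -- most 1, which doubles the weight. Otherwise the length is now at most 2, and the last summand
  -- is the weight of length 2.
  weight-after-round : ∀ n p w c ℓ → ℓ ≤ suc (matched p (c ∷ w)) →
    weight n p ℓ ≤ 2 * charge p w (weight n p (matched p w)) c + 2 ^ (suc n ∸ ⌈ p ∸ 2 /2⌉)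
  weight-after-round n p w c ℓ ℓ≤ with does (repeats? p w c)
  ... | false = weight-mono n p (≤-trans ℓ≤ (n≤1+n 1)) (s≤s z≤n)
  ... | true with matched p w
  ...   | zero  = weight-mono n p ℓ≤ (s≤s z≤n)
  ...   | suc m = ≤-trans (≤-trans (weight-mono n p ℓ≤ (s≤s z≤n)) (^-monoʳ-≤ 2 exponents)) (m≤m+n _ _)
    where
    x : ℕ
    x = ⌈ p ∸ suc m /2⌉
    y : ℕ
    y = ⌈ p ∸ (3 + m) /2⌉
    x≤1+y : x ≤ suc y
    x≤1+y = subst (λ z → x ≤ suc ⌈ z /2⌉)
      (trans (∸-+-assoc p (suc m) 2) (cong (p ∸_) (+-comm (suc m) 2))) (⌈n/2⌉≤1+⌈[n∸2]/2⌉ (p ∸ suc m))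
    exponents : suc n ∸ y ≤ suc (suc n ∸ x)
    exponents = ≤-trans (∸-monoʳ-≤ (suc (suc n)) x≤1+y) (suc-∸-≤ (suc n) x)

  -- The hypotheses on `w′` fit both outcomes of Ben's move: `c ∷ w` after a pass and `b ∷ c ∷ w`
  -- otherwise.
  module Round (n : ℕ) (w : Word k) (c : Fin k) (w′ : Word k)
               (linked : Linked _≢_ w′)
               (matched≤ : ∀ p → matched p w′ ≤ suc (matched p (c ∷ w))) where

    new : ℕ → ℕ
    new j = weight n (3 + j) (matched (3 + j) w′)

    old : ℕ → ℕ
    old = continued n w c

    new≤ : ∀ j i → ⌈ suc j /2⌉ ≡ suc i → new j ≤ 2 * old j + 2 ^ (n ∸ i)
    new≤ j i eq = subst (λ e → new j ≤ 2 * old j + 2 ^ (suc n ∸ e)) eq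
      (weight-after-round n (3 + j) w c _ (matched≤ (3 + j)))

    -- For periods `3 + i * 2` and `4 + i * 2` the weight of length 2 is the same, `2 ^ (n ∸ i)`; it
    -- is paid only once because one of the two periods matches nothing.
    new-pair≤ : ∀ i → new (i * 2) + new (1 + i * 2) ≤ 2 * (old (i * 2) + old (1 + i * 2)) + 2 ^ (n ∸ i)
    new-pair≤ i with matched-p⊎1+p≡0 (3 + i * 2) linked
    ... | inj₁ eq = begin
      new (i * 2) + new (1 + i * 2) ≡⟨ cong (λ ℓ → weight n (3 + i * 2) ℓ + new (1 + i * 2)) eq ⟩
      new (1 + i * 2)               ≤⟨ new≤ (1 + i * 2) i (cong suc (⌈n*2/2⌉≡n i)) ⟩
      2 * old (1 + i * 2) + 2 ^ (n ∸ i) ≤⟨ +-monoˡ-≤ (2 ^ (n ∸ i)) (*-monoʳ-≤ 2 (m≤n+m _ (old (i * 2)))) ⟩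
      2 * (old (i * 2) + old (1 + i * 2)) + 2 ^ (n ∸ i) ∎
    ... | inj₂ eq = begin
      new (i * 2) + new (1 + i * 2) ≡⟨ cong (λ ℓ → new (i * 2) + weight n (4 + i * 2) ℓ) eq ⟩
      new (i * 2) + 0               ≡⟨ +-identityʳ _ ⟩
      new (i * 2)                   ≤⟨ new≤ (i * 2) i (cong suc (⌊n*2/2⌋≡n i)) ⟩
      2 * old (i * 2) + 2 ^ (n ∸ i) ≤⟨ +-monoˡ-≤ (2 ^ (n ∸ i)) (*-monoʳ-≤ 2 (m≤m+n (old (i * 2)) _)) ⟩
      2 * (old (i * 2) + old (1 + i * 2)) + 2 ^ (n ∸ i) ∎

    -- The geometric sum of the new contributions, with the remainder 2^(1+n-m) carried along.
    Σ-new≤ : ∀ m → m ≤ n → Σ< (m * 2) new + 2 ^ (suc n ∸ m) ≤ 2 * Σ< (m * 2) old + 2 ^ suc n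
    Σ-new≤ zero    _   = ≤-refl
    Σ-new≤ (suc m) m<n = begin
      S + new (m * 2) + new (1 + m * 2) + e           ≡⟨ cong (_+ e) (+-assoc S _ _) ⟩
      S + (new (m * 2) + new (1 + m * 2)) + e         ≤⟨ +-monoˡ-≤ e (+-monoʳ-≤ S (new-pair≤ m)) ⟩
      S + (2 * o + e) + e                             ≡⟨ rearrange₁ S o e ⟩
      -- As `m ≤ n`, subtraction does not truncate, and the two copies of `e` make up the previous
      -- remainder.
      S + 2 * e + 2 * o                               ≡⟨ cong (λ x → S + 2 ^ x + 2 * o) (sym (+-∸-assoc 1 (<⇒≤ m<n))) ⟩
      S + 2 ^ (suc n ∸ m) + 2 * o                     ≤⟨ +-monoˡ-≤ (2 * o) (Σ-new≤ m (<⇒≤ m<n)) ⟩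
      2 * T + 2 ^ suc n + 2 * o                       ≡⟨ rearrange₂ T (2 ^ suc n) (old (m * 2)) (old (1 + m * 2)) ⟩
      2 * (T + old (m * 2) + old (1 + m * 2)) + 2 ^ suc n ∎
      where
      S : ℕ
      S = Σ< (m * 2) new
      T : ℕ
      T = Σ< (m * 2) old
      e : ℕ
      e = 2 ^ (n ∸ m)
      o : ℕ
      o = old (m * 2) + old (1 + m * 2)
      rearrange₁ : ∀ S o e → S + (2 * o + e) + e ≡ S + 2 * e + 2 * o
      rearrange₁ = solve-∀
      rearrange₂ : ∀ T E x y → 2 * T + E + 2 * (x + y) ≡ 2 * (T + x + y) + E
      rearrange₂ = solve-∀

    Φ-after-round : cost n w c < 2 ^ n → Φ n w′ < 2 ^ (2 + n)
    Φ-after-round lt = begin-strict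
      Φ n w′                            ≤⟨ m≤m+n _ _ ⟩
      Φ n w′ + 2 ^ (suc n ∸ n)          ≤⟨ Σ-new≤ n ≤-refl ⟩
      2 * Σ< (n * 2) old + 2 ^ suc n
        <⟨ +-monoˡ-< (2 ^ suc n) (*-monoʳ-< 2 (≤-<-trans (Σ-continued≤cost n w c) lt)) ⟩
      2 * 2 ^ n + 2 ^ suc n             ≡⟨ cong (2 * 2 ^ n +_) (sym (+-identityʳ _)) ⟩
      2 ^ (2 + n) ∎

  -- Safe words and one round of play

  record Safe (n : ℕ) (w : Word k) : Set where
    field
      length≤ : length w ≤ n
      linked  : Linked _≢_ w
      Φ<      : Φ n w < 2 ^ (2 + n)

  Safe-suc : ∀ {n w} → Safe n w → Safe (suc n) w
  Safe-suc {n} {w} s = record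
    { length≤ = m≤n⇒m≤1+n length≤
    ; linked  = linked
    ; Φ<      = ≤-<-trans (Φ-suc n w length≤) (*-monoʳ-< 2 Φ<)
    } where open Safe s

  linked-∷ : ∀ {c} {w : Word k} → head w ≢ just c → Linked _≢_ w → Linked _≢_ (c ∷ w)
  linked-∷ {w = []}    _   _ = [-]
  linked-∷ {w = x ∷ w} x≢c l = (x≢c ∘ cong just ∘ sym) ∷ l

  noSquareSuffix-ann : ∀ n w c → length w ≤ n → cost n w c < 2 ^ n → NoSquareSuffix (c ∷ w)
  noSquareSuffix-ann n w c w≤n lt (suc zero)    _ = ≤-reflexive (cong suc (matched-∷-no 1 c w (cost<⇒≢last n w c lt)))
  noSquareSuffix-ann n w c w≤n lt p@(suc (suc _)) _ =
    ≤-trans (n≤1+n _) (cost<⇒matched n w c w≤n lt p (s≤s (s≤s z≤n)))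

  -- Period 1 is excluded by `b ≢ c`; for any other period Ben supplies only one of the two missing
  -- letters.
  noSquareSuffix-ben : ∀ n w c b → b ≢ c → length w ≤ n → cost n w c < 2 ^ n → NoSquareSuffix (b ∷ c ∷ w)
  noSquareSuffix-ben n w c b b≢c w≤n lt (suc zero)    _ =
    ≤-reflexive (cong suc (matched-∷-no 1 b (c ∷ w) λ { refl → b≢c refl }))
  noSquareSuffix-ben n w c b b≢c w≤n lt p@(suc (suc _)) _ =
    ≤-trans (s≤s (matched-∷≤ p b (c ∷ w))) (cost<⇒matched n w c w≤n lt p (s≤s (s≤s z≤n)))

  reverse-move : ∀ (w : Word k) {a} → NoSquareSuffix (a ∷ reverse w) → reverse (move w a) ≡ a ∷ reverse w
  reverse-move w {a} sf = trans (cong reverse (move-reverse w a))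
    (trans (reverse-involutive _) (eraseRev-noSquareSuffix (suc (length w)) 1 (a ∷ reverse w) ≤-refl sf))

  reverse-move-double : ∀ (w : Word k) {a v} → reverse w ≡ a ∷ v → reverse (move w a) ≡ a ∷ v
  reverse-move-double w {a} {v} eq = trans (cong reverse (move-reverse w a))
    (trans (reverse-involutive _)
      (trans (cong (λ u → eraseRev (suc (length w)) 1 (a ∷ u)) eq) (eraseRev-double (length w) a v)))

  -- Ann's letter always survives, and Ben's is either kept or erased alone, so the word grows by
  -- one or two letters; `n` leaves room for both.
  round : ∀ n (w : Word k) c b → 2 + length w ≤ n → Linked _≢_ (reverse w) → cost n (reverse w) c < 2 ^ n →
          Safe n (reverse (move (move w c) b)) × length w < length (move (move w c) b)
  round n w c b 2+w≤n linked lt = result (b ≟ᶠ c)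
    where
    v w₁ w₂ : Word k
    v  = reverse w
    w₁ = move w c
    w₂ = move w₁ b

    v≤n : length v ≤ n
    v≤n = ≤-trans (≤-reflexive (length-reverse w)) (≤-trans (m≤n+m (length w) 2) 2+w≤n)

    afterAnn : reverse w₁ ≡ c ∷ v
    afterAnn = reverse-move w (noSquareSuffix-ann n v c v≤n lt)

    linked₁ : Linked _≢_ (c ∷ v)
    linked₁ = linked-∷ (cost<⇒≢last n v c lt) linked

    finish : ∀ v′ → reverse w₂ ≡ v′ → Linked _≢_ v′ → (∀ p → matched p v′ ≤ suc (matched p (c ∷ v))) →
             length v′ ≤ 2 + length v → length v < length v′ →
             Safe n (reverse w₂) × length w < length w₂
    finish v′ refl linked′ matched≤ ≤2+ grows = record
      { length≤ = ≤-trans ≤2+ (subst (λ l → 2 + l ≤ n) (sym (length-reverse w)) 2+w≤n)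
      ; linked  = linked′
      ; Φ<      = Round.Φ-after-round n v c v′ linked′ matched≤ lt
      }
      , ≤-trans (≤-reflexive (cong suc (sym (length-reverse w)))) (≤-trans grows (≤-reflexive (length-reverse w₂)))

    result : Dec (b ≡ c) → Safe n (reverse w₂) × length w < length w₂
    result (yes refl) = finish (c ∷ v) (reverse-move-double w₁ afterAnn) linked₁ (λ p → n≤1+n _) (n≤1+n _) ≤-refl
    result (no b≢c)   = finish (b ∷ c ∷ v)
      (trans (reverse-move w₁ (subst (NoSquareSuffix ∘ (b ∷_)) (sym afterAnn) (noSquareSuffix-ben n v c b b≢c v≤n lt)))
             (cong (b ∷_) afterAnn))
      (b≢c ∷ linked₁) (λ p → matched-∷≤ p b (c ∷ v)) ≤-refl (n≤1+n _)

-- Ann's strategy along the play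

annTurn-even : ∀ t → annTurn (t * 2) ≡ true
annTurn-even zero    = refl
annTurn-even (suc t) rewrite annTurn-even t = refl

play-even : ∀ {k} (ann ben : Strategy k) t → play ann ben (2 + t * 2) ≡
  (let (h , w) = play ann ben (t * 2)
       a = ann h
       b = ben (h ++ [ a ])
   in (h ++ [ a ]) ++ [ b ] , move (move w a) b)
play-even ann ben t rewrite annTurn-even t = refl

module Game (k : ℕ) (6≤k : 6 ≤ k) where

  cheapLetter : ℕ → Word k → Fin k
  cheapLetter n w with any? (λ c → cost n w c <? 2 ^ n)
  ... | yes (c , _) = c
  -- A default letter; `cost-cheapLetter` rules this case out while the potential is below its
  -- bound.
  ... | no _        = inject≤ zero 6≤k

  -- By averaging: if every letter cost at least `2 ^ n`, the total would reach `k * 2 ^ n`, but it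
  -- is below `6 * 2 ^ n`.
  cost-cheapLetter : ∀ n w → Φ n w < 2 ^ (2 + n) → cost n w (cheapLetter n w) < 2 ^ n
  cost-cheapLetter n w Φ< with any? (λ c → cost n w c <? 2 ^ n)
  ... | yes (c , lt) = lt
  ... | no ¬∃ = contradiction sum< (≤⇒≯ (sum-lowerBound (cost n w) (λ c → ≮⇒≥ (λ lt → ¬∃ (c , lt)))))
    where
    six : ∀ u → u + (u + 2 * (2 * u)) ≡ 6 * u
    six = solve-∀
    sum< : sum (cost n w) < k * 2 ^ n
    sum< = begin-strict
      sum (cost n w)                   ≤⟨ sum-cost n w ⟩
      2 ^ n + (2 ^ n + Φ n w)          <⟨ +-monoʳ-< (2 ^ n) (+-monoʳ-< (2 ^ n) Φ<) ⟩
      2 ^ n + (2 ^ n + 2 ^ (2 + n))    ≡⟨ six (2 ^ n) ⟩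
      6 * 2 ^ n                        ≤⟨ *-monoˡ-≤ (2 ^ n) 6≤k ⟩
      k * 2 ^ n                        ∎

  wordOf : List (Fin k) → Word k
  wordOf = foldl move []

  -- The word is recovered by replaying the history; the scale `2 + length h` bounds the word's
  -- length after the coming round.
  ann : Strategy k
  ann h = cheapLetter (2 + length h) (reverse (wordOf h))

  record Invariant (t : ℕ) (h : List (Fin k)) (w : Word k) : Set where
    field
      length-h : length h ≡ t * 2
      word     : wordOf h ≡ w
      safe     : Safe (t * 2) (reverse w)
      long     : t ≤ length w

  Invariant-round : ∀ {t h w} b → Invariant t h w →
                    Invariant (suc t) ((h ++ [ ann h ]) ++ [ b ]) (move (move w (ann h)) b)
  Invariant-round {t} {h} b record { length-h = length-h ; word = refl ; safe = safe ; long = long } = record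
    { length-h = trans (length-++-∷ (h ++ [ ann h ])) (cong suc (trans (length-++-∷ h) (cong suc length-h)))
    ; word     = trans (foldl-∷ʳ move [] b (h ++ [ ann h ])) (cong (λ w → move w b) (foldl-∷ʳ move [] (ann h) h))
    ; safe     = proj₁ after
    ; long     = ≤-trans (s≤s long) (proj₂ after)
    }
    where
    length-++-∷ : ∀ (h : List (Fin k)) {a} → length (h ++ [ a ]) ≡ suc (length h)
    length-++-∷ h = trans (length-++ h) (+-comm (length h) 1)
    v : Word k
    v = reverse (wordOf h)
    safe₂ : Safe (2 + t * 2) v
    -- The scale is raised by two before Ann moves, to match the one used by `ann`.
    safe₂ = Safe-suc (Safe-suc safe)
    cheap : cost (2 + t * 2) v (ann h) < 2 ^ (2 + t * 2)
    cheap = subst (λ n → cost (2 + t * 2) v (cheapLetter (2 + n) v) < 2 ^ (2 + t * 2)) (sym length-h)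
              (cost-cheapLetter (2 + t * 2) v (Safe.Φ< safe₂))
    w₂ : Word k
    w₂ = move (move (wordOf h) (ann h)) b
    after : Safe (2 + t * 2) (reverse w₂) × length (wordOf h) < length w₂
    after = round (2 + t * 2) (wordOf h) (ann h) b
      (+-monoʳ-≤ 2 (subst (_≤ t * 2) (length-reverse (wordOf h)) (Safe.length≤ safe)))
      (Safe.linked safe) cheap

  invariant : ∀ ben t → Invariant t (proj₁ (play ann ben (t * 2))) (proj₂ (play ann ben (t * 2)))
  invariant ben zero    = record
    { length-h = refl
    ; word     = refl
    ; safe     = record { length≤ = z≤n ; linked = [] ; Φ< = s≤s z≤n }
    ; long     = z≤n
    }
  invariant ben (suc t) = subst (λ (h , w) → Invariant (suc t) h w) (sym (play-even ann ben t))
    (Invariant-round _ (invariant ben t))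

theorem2 : (k : ℕ) → 6 ≤ k → Σ (Strategy k) λ ann → (ben : Strategy k) → (N : ℕ) → ∃ λ n → N ≤ wordLength ann ben n
-- Each round of two moves adds at least one letter, so `N * 2` moves suffice.
theorem2 k 6≤k = ann , λ ben N → N * 2 , Invariant.long (invariant ben N)
  where open Game k 6≤k
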